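{- Every block graph $G$ is hangable; that is, if $G$ is a connected graph in which every block is a complete graph, then $P_G(v)\subseteq P(G)$ for every vertex $v$ of $G$.
   Context: All graphs are finite, simple, undirected, with nonempty vertex set. For a connected graph $G=(V_G,E_G)$, $d_G(u,v)$ is the length of a shortest $u$--$v$ path. The eccentricity of $v$ is $e_G(v)=\max\{d_G(v,u): u\in V_G\}$ and the diameter is $d(G)=\max\{e_G(v): v\in V_G\}$. The periphery of a vertex $v$ is $P_G(v)=\{u\in V_G: d_G(v,u)=e_G(v)\}$; the periphery of $G$ is $P(G)=\{v\in V_G: e_G(v)=d(G)\}$. A connected graph $G$ is hangable if $P_G(v)\subseteq P(G)$ for every $v\in V_G$. A block graph is a connected graph in which every block (maximal 2-connected subgraph, where as usual a bridge together with its end vertices also counts as a block $K_2$) is a complete graph. -}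

module Defs where

open import Data.Fin using (Fin; _≟_)
open import Data.Fin.Subset using (Subset; _∈_; _∪_; _-_; ⁅_⁆; ∣_∣; Nonempty) renaming (_⊆_ to _⊆ˢ_)
open import Data.Fin.Subset.Properties using (x∈p∧x≢y⇒x∈p-y)
open import Data.List using (List; []; _∷_)
open import Data.List.Relation.Unary.Unique.Propositional using (Unique)
open import Data.Nat using (ℕ; zero; suc; _≤_; _<_)
open import Data.Product using (Σ; ∃-syntax; _×_; _,_; proj₁)
open import Data.Sum using (_⊎_)
open import Level using (0ℓ)
open import Relation.Binary.Construct.Closure.ReflexiveTransitive using (Star; ε; _◅_)
open import Relation.Binary.Core using (Rel)
open import Relation.Binary.Definitions using (Decidable; Symmetric; Irreflexive)
open import Relation.Binary.PropositionalEquality using (_≡_; _≢_)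
open import Relation.Nullary using (¬_; ¬?; _×-dec_)
open import Relation.Unary using (Pred; _⊆_)

-- The vertex set is a subset of an ambient Fin n, so that subgraphs and
-- graphs obtained by deletion are again terms of Graph n.  It may be empty
-- here; nonemptiness is part of Connected.
record Graph (n : ℕ) : Set₁ where
  field
    V      : Subset n
    Adj    : Rel (Fin n) 0ℓ
    adj?   : Decidable Adj
    sym    : Symmetric Adj
    irrefl : Irreflexive _≡_ Adj
    adj⇒∈  : ∀ {u v} → Adj u v → u ∈ V

open Graph public

module _ {n : ℕ} where

  Walk : Graph n → Rel (Fin n) 0ℓ
  Walk G = Star (Adj G)

  length : (G : Graph n) {u v : Fin n} → Walk G u v → ℕ
  length G ε       = zero
  length G (_ ◅ w) = suc (length G w)

  vertices : (G : Graph n) {u v : Fin n} → Walk G u v → List (Fin n)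
  vertices G {u} ε       = u ∷ []
  vertices G {u} (_ ◅ w) = u ∷ vertices G w

  -- The trivial path ε exists at every element of Fin n, so paths are only
  -- meaningful between members of V G.
  Path : Graph n → Rel (Fin n) 0ℓ
  Path G u v = Σ (Walk G u v) λ w → Unique (vertices G w)

  Connected : Graph n → Set
  Connected G = Nonempty (V G) × (∀ {u v} → u ∈ V G → v ∈ V G → Path G u v)

  IsMinimum IsMaximum : Pred ℕ 0ℓ → Pred ℕ 0ℓ
  IsMinimum S k = S k × (∀ {m} → S m → k ≤ m)
  IsMaximum S k = S k × (∀ {m} → S m → m ≤ k)

  -- Distance, eccentricity and diameter are given by their graphs:
  -- Distance G u v k says d_G(u,v) = k, and similarly for the other two.
  Distance : Graph n → Fin n → Fin n → Pred ℕ 0ℓ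
  Distance G u v = IsMinimum λ k → Σ (Path G u v) λ p → length G (proj₁ p) ≡ k

  Eccentricity : Graph n → Fin n → Pred ℕ 0ℓ
  Eccentricity G v = IsMaximum λ k → ∃[ u ] u ∈ V G × Distance G v u k

  Diameter : Graph n → Pred ℕ 0ℓ
  Diameter G = IsMaximum λ k → ∃[ v ] v ∈ V G × Eccentricity G v k

  PeripheryOf : Graph n → Fin n → Pred (Fin n) 0ℓ
  PeripheryOf G v u = u ∈ V G × ∃[ k ] Distance G v u k × Eccentricity G v k

  Periphery : Graph n → Pred (Fin n) 0ℓ
  Periphery G v = v ∈ V G × ∃[ k ] Eccentricity G v k × Diameter G k

  Hangable : Graph n → Set
  Hangable G = Connected G × (∀ {v} → v ∈ V G → PeripheryOf G v ⊆ Periphery G)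

  -- Subgraphs need not be induced.
  _⊑_ : Graph n → Graph n → Set
  H ⊑ G = V H ⊆ˢ V G × (∀ {u v} → Adj H u v → Adj G u v)

  deleteVertex : Graph n → Fin n → Graph n
  deleteVertex G x = record
    { V      = V G - x
    ; Adj    = λ u v → Adj G u v × u ≢ x × v ≢ x
    ; adj?   = λ u v → adj? G u v ×-dec ¬? (u ≟ x) ×-dec ¬? (v ≟ x)
    ; sym    = λ (uv , u≢x , v≢x) → sym G uv , v≢x , u≢x
    ; irrefl = λ u≡v (uv , _) → irrefl G u≡v uv
    ; adj⇒∈  = λ (uv , u≢x , _) → x∈p∧x≢y⇒x∈p-y (adj⇒∈ G uv) u≢x
    }

  deleteEdge : Graph n → Fin n → Fin n → Graph n
  deleteEdge G x y = record
    { V      = V G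
    ; Adj    = λ u v → Adj G u v × ¬ (u ≡ x × v ≡ y) × ¬ (v ≡ x × u ≡ y)
    ; adj?   = λ u v → adj? G u v ×-dec ¬? (u ≟ x ×-dec v ≟ y)
                                  ×-dec ¬? (v ≟ x ×-dec u ≟ y)
    ; sym    = λ (uv , p , q) → sym G uv , q , p
    ; irrefl = λ u≡v (uv , _) → irrefl G u≡v uv
    ; adj⇒∈  = λ (uv , _) → adj⇒∈ G uv
    }

  TwoConnected : Graph n → Set
  TwoConnected G =
    2 < ∣ V G ∣ × Connected G × (∀ {x} → x ∈ V G → Connected (deleteVertex G x))

  MaximalTwoConnected : Graph n → Graph n → Set₁
  MaximalTwoConnected G B =
    B ⊑ G × TwoConnected B × (∀ H → H ⊑ G → TwoConnected H → B ⊑ H → H ⊑ B)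

  Bridge : Graph n → Rel (Fin n) 0ℓ
  Bridge G u v = Adj G u v × ¬ Path (deleteEdge G u v) u v

  BridgeSubgraph : Graph n → Graph n → Set
  BridgeSubgraph G B =
    ∃[ u ] ∃[ v ] Bridge G u v × B ⊑ G × V B ≡ ⁅ u ⁆ ∪ ⁅ v ⁆ × Adj B u v

  -- A graph with a single vertex has no blocks; counting it as a block of
  -- itself would not affect BlockGraph, since it is complete.
  Block : Graph n → Graph n → Set₁
  Block G B = MaximalTwoConnected G B ⊎ BridgeSubgraph G B

  Complete : Graph n → Set
  Complete G = ∀ {u v} → u ∈ V G → v ∈ V G → u ≢ v → Adj G u v

  BlockGraph : Graph n → Set₁
  BlockGraph G = Connected G × (∀ B → Block G B → Complete B)

{-# OPTIONS --safe #-}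
-- In a block graph any two neighbours a, b of a vertex x that are joined by a
-- walk avoiding x are adjacent, because they lie on a common cycle, hence in
-- a common block.  Consequently, seen from any vertex r, two neighbours of x
-- that are no farther from r than x is are equal or adjacent.  So along a
-- geodesic the distance to r can only increase after the first step that does
-- not decrease it, which yields Howorka's four-point condition
--   d(u,v) + d(a,b) ≤ max (d(a,u) + d(b,v), d(b,u) + d(a,v)).
-- Taking u in the periphery of v and a, b at distance d(G), one of a, b is at
-- distance at least d(G) from u.
module Submission where

open import Data.Fin using (Fin; _≟_)
open import Data.Fin.Properties using (any?)
open import Data.Fin.Subset using (Subset; _∈_; _∉_; _∪_; _-_; ⁅_⁆; ∣_∣)
  renaming (⊥ to ∅; _⊆_ to _⊆ˢ_)
open import Data.Fin.Subset.Properties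
open import Data.List using (List; []; _∷_; foldr; filter; allFin; cartesianProduct)
open import Data.List.Extrema.Nat using (argmax; argmax-all; f[xs]≤f[argmax])
open import Data.List.Membership.Propositional using () renaming (_∈_ to _∈ˡ_)
open import Data.List.Membership.Propositional.Properties
  using (∈-filter⁺; ∈-filter⁻; ∈-allFin; ∈-cartesianProduct⁺; ∈-cartesianProduct⁻)
open import Data.List.Membership.DecPropositional using () renaming (_∈?_ to _∈ˡ?_)
open import Data.List.Relation.Binary.Subset.Propositional using () renaming (_⊆_ to _⊆ˡ_)
open import Data.List.Relation.Unary.All as All using ([])
open import Data.List.Relation.Unary.All.Properties using (¬Any⇒All¬)
open import Data.List.Relation.Unary.AllPairs using ([]; _∷_)
open import Data.List.Relation.Unary.Any using (here; there)
open import Data.List.Relation.Unary.Unique.Propositional using (Unique)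
open import Data.Nat using (ℕ; zero; suc; _+_; _≤_; _<_; z≤n; s≤s; s≤s⁻¹)
open import Data.Nat.Properties hiding (_≟_)
open import Data.Product using (Σ; ∃; ∃-syntax; _×_; _,_; proj₁; proj₂; uncurry)
open import Data.Sum using (_⊎_; inj₁; inj₂)
open import Function using (id; _∘_)
open import Level using (0ℓ)
open import Relation.Binary.Construct.Closure.ReflexiveTransitive as Star
  using (ε; _◅_; _◅◅_)
open import Relation.Binary.Definitions using (tri<; tri≈; tri>)
open import Relation.Binary.PropositionalEquality
  using (_≡_; _≢_; refl; trans; cong; cong₂; subst; ≢-sym) renaming (sym to ≡-sym)
open import Relation.Nullary using (¬_; Dec; yes; no; contradiction; _×-dec_; ¬?)
open import Relation.Nullary.Decidable using (map′; decidable-stable)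
open import Relation.Unary using (Pred; Decidable)
open import Defs

module _ {n : ℕ} where

  adj⇒∈ʳ : (G : Graph n) {u v : Fin n} → Adj G u v → v ∈ V G
  adj⇒∈ʳ G uv = adj⇒∈ G (sym G uv)

  -- Walks and connectivity

  length-◅◅ : (G : Graph n) {u v w : Fin n} (p : Walk G u v) (q : Walk G v w) →
              length G (p ◅◅ q) ≡ length G p + length G q
  length-◅◅ G ε       q = refl
  length-◅◅ G (_ ◅ p) q = cong suc (length-◅◅ G p q)

  length-revApp : (G : Graph n) {u v w : Fin n} (p : Walk G v u) (q : Walk G v w) →
                  length G (Star.revApp (sym G) p q) ≡ length G p + length G q
  length-revApp G ε       q = refl
  length-revApp G (e ◅ p) q =
    trans (length-revApp G p (sym G e ◅ q)) (+-suc (length G p) (length G q))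

  length-reverse : (G : Graph n) {u v : Fin n} (p : Walk G u v) →
                   length G (Star.reverse (sym G) p) ≡ length G p
  length-reverse G p = trans (length-revApp G p ε) (+-identityʳ _)

  start∈vertices : (G : Graph n) {u v : Fin n} (w : Walk G u v) → u ∈ˡ vertices G w
  start∈vertices G ε       = here refl
  start∈vertices G (_ ◅ _) = here refl

  end∈vertices : (G : Graph n) {u v : Fin n} (w : Walk G u v) → v ∈ˡ vertices G w
  end∈vertices G ε       = here refl
  end∈vertices G (_ ◅ w) = there (end∈vertices G w)

  vertices⊆V : (G : Graph n) {u v z : Fin n} → u ∈ V G → (w : Walk G u v) →
               z ∈ˡ vertices G w → z ∈ V G
  vertices⊆V G u∈ ε       (here refl) = u∈
  vertices⊆V G u∈ (_ ◅ _) (here refl) = u∈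
  vertices⊆V G u∈ (e ◅ w) (there z∈)  = vertices⊆V G (adj⇒∈ʳ G e) w z∈

  -- The walk is cut at the occurrence of `z` that the membership proof points to. The length and
  -- uniqueness components serve loop erasure; the inclusion shows that the rest still avoids
  -- whatever `w` avoids.
  suffix : (G : Graph n) {u v z : Fin n} (w : Walk G u v) → z ∈ˡ vertices G w →
           Σ (Walk G z v) λ w′ → length G w′ ≤ length G w
                               × vertices G w′ ⊆ˡ vertices G w
                               × (Unique (vertices G w) → Unique (vertices G w′))
  suffix G ε       (here refl) = ε , z≤n , id , id
  suffix G (e ◅ w) (here refl) = e ◅ w , ≤-refl , id , id
  suffix G (e ◅ w) (there z∈)  with suffix G w z∈
  ... | w′ , len , sub , uniq = w′ , m≤n⇒m≤1+n len , there ∘ sub , λ { (_ ∷ u) → uniq u }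

  -- Connectivity and distance are defined by paths, while walks are easier to join and reverse. The
  -- length bound makes shortest walks and shortest paths equally long.
  loopErasure : (G : Graph n) {u v : Fin n} (w : Walk G u v) →
                Σ (Path G u v) λ p → length G (proj₁ p) ≤ length G w
  loopErasure G ε = (ε , [] ∷ []) , z≤n
  loopErasure G {u} (e ◅ w) with loopErasure G w
  ... | (p , uniq) , len with _∈ˡ?_ _≟_ u (vertices G p)
  ...   | no u∉ = (e ◅ p , ¬Any⇒All¬ _ u∉ ∷ uniq) , s≤s len
  ...   | yes u∈ with suffix G p u∈
  ...     | p′ , len′ , _ , uniq′ = (p′ , uniq′ uniq) , m≤n⇒m≤1+n (≤-trans len′ len)

  hub⇒connected : (G : Graph n) {h : Fin n} → h ∈ V G →
                  (∀ {z} → z ∈ V G → Walk G z h) → Connected G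
  hub⇒connected G h∈ toHub =
    (_ , h∈) ,
    λ u∈ v∈ → proj₁ (loopErasure G (toHub u∈ ◅◅ Star.reverse (sym G) (toHub v∈)))

  connected-spanning : (H K : Graph n) → V H ⊆ˢ V K → V K ⊆ˢ V H →
                       (∀ {u v} → Adj H u v → Adj K u v) → Connected H → Connected K
  connected-spanning H K H⊆K K⊆H f ((z , z∈) , path) =
    (z , H⊆K z∈) ,
    λ u∈ v∈ → proj₁ (loopErasure K (Star.map f (proj₁ (path (K⊆H u∈) (K⊆H v∈)))))

  restrict : (G K : Graph n) {Q : Pred (Fin n) 0ℓ} →
             (∀ {p q} → Adj G p q → Q p → Q q → Adj K p q) →
             ∀ {u v} (w : Walk G u v) → (∀ {z} → z ∈ˡ vertices G w → Q z) → Walk K u v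
  restrict G K f ε       Q-all = ε
  restrict G K f (e ◅ w) Q-all =
    f e (Q-all (here refl)) (Q-all (there (start∈vertices G w))) ◅
    restrict G K f w (Q-all ∘ there)

  -- A vertex y occurs at most once on a path, so from any other vertex of
  -- the path one of its two ends can be reached without meeting y.
  pathEnd : (G K : Graph n) {T : Pred (Fin n) 0ℓ} {y : Fin n} →
            (∀ {p q} → Adj G p q → T p × p ≢ y → T q × q ≢ y → Adj K p q) →
            ∀ {u v z} (w : Walk G u v) → Unique (vertices G w) →
            (∀ {z} → z ∈ˡ vertices G w → T z) → z ∈ˡ vertices G w → z ≢ y →
            (u ≢ y × Walk K z u) ⊎ (v ≢ y × Walk K z v)
  pathEnd G K f ε       _ _ (here refl) z≢y = inj₁ (z≢y , ε)
  pathEnd G K f (_ ◅ _) _ _ (here refl) z≢y = inj₁ (z≢y , ε)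
  pathEnd G K {T} {y} f {u} (e ◅ w) (u∉w ∷ uniq) T-all (there z∈) z≢y with u ≟ y
  ... | yes refl with suffix G w z∈
  ...   | w′ , _ , sub , _ =
          inj₂ ( ≢-sym (All.lookup u∉w (end∈vertices G w))
               , restrict G K f w′ λ z∈′ →
                   T-all (there (sub z∈′)) , ≢-sym (All.lookup u∉w (sub z∈′)))
  pathEnd G K {T} {y} f {u} (e ◅ w) (u∉w ∷ uniq) T-all (there z∈) z≢y | no u≢y
    with pathEnd G K {T} f w uniq (T-all ∘ there) z∈ z≢y
  ... | inj₂ toEnd = inj₂ toEnd
  ... | inj₁ (c≢y , toStart) =
    inj₁ (u≢y , toStart ◅◅ sym K (f e (T-all (here refl) , u≢y)
                                      (T-all (there (start∈vertices G w)) , c≢y)) ◅ ε)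

  -- Cycles and blocks

  induced : Graph n → Subset n → Graph n
  induced G S = record
    { V      = S
    ; Adj    = λ u v → Adj G u v × u ∈ S × v ∈ S
    ; adj?   = λ u v → adj? G u v ×-dec u ∈? S ×-dec v ∈? S
    ; sym    = λ (uv , u∈ , v∈) → sym G uv , v∈ , u∈
    ; irrefl = λ u≡v (uv , _) → irrefl G u≡v uv
    ; adj⇒∈  = λ (_ , u∈ , _) → u∈
    }

  fromList : List (Fin n) → Subset n
  fromList = foldr (λ x S → ⁅ x ⁆ ∪ S) ∅

  ∈-fromList⁺ : ∀ {x xs} → x ∈ˡ xs → x ∈ fromList xs
  ∈-fromList⁺ (here refl) = x∈p∪q⁺ (inj₁ (x∈⁅x⁆ _))
  ∈-fromList⁺ (there x∈)  = x∈p∪q⁺ (inj₂ (∈-fromList⁺ x∈))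

  ∈-fromList⁻ : ∀ {x} xs → x ∈ fromList xs → x ∈ˡ xs
  ∈-fromList⁻ []       x∈ = contradiction x∈ ∉⊥
  ∈-fromList⁻ (y ∷ xs) x∈ with x∈p∪q⁻ ⁅ y ⁆ (fromList xs) x∈
  ... | inj₁ x∈y  = here (x∈⁅y⁆⇒x≡y y x∈y)
  ... | inj₂ x∈xs = there (∈-fromList⁻ xs x∈xs)

  x∈p-y⇒x∈p : ∀ {x y} {p : Subset n} → x ∈ p - y → x ∈ p
  x∈p-y⇒x∈p = p─q⊆p _ _

  -- If `x` survived its own deletion, `p` would be contained in `p - x`, although `p - x` would
  -- then be a proper subset of `p`.
  x∉p-x : ∀ x (p : Subset n) → x ∉ p - x
  x∉p-x x p x∈ = contradiction (p⊂q⇒∣p∣<∣q∣ (x∈p⇒p-x⊂p (x∈p-y⇒x∈p x∈)))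
    (≤⇒≯ (p⊆q⇒∣p∣≤∣q∣ λ {z} z∈ → keep z z∈))
    where
    keep : ∀ z → z ∈ p → z ∈ p - x
    keep z z∈ with z ≟ x
    ... | yes refl = x∈
    ... | no z≢x   = x∈p∧x≢y⇒x∈p-y z∈ z≢x

  x∈p-y⇒x≢y : ∀ {x y} {p : Subset n} → x ∈ p - y → x ≢ y
  x∈p-y⇒x≢y {x} {p = p} x∈ refl = x∉p-x x p x∈

  2<∣p∣ : ∀ {x y z} {p : Subset n} → x ∈ p → y ∈ p → z ∈ p →
          y ≢ x → z ≢ x → z ≢ y → 2 < ∣ p ∣
  2<∣p∣ x∈ y∈ z∈ y≢x z≢x z≢y =
    ≤-trans (s≤s (≤-trans (s≤s (≤-trans (s≤s z≤n) (x∈p⇒∣p-x∣<∣p∣ z∈″)))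
                          (x∈p⇒∣p-x∣<∣p∣ y∈′)))
            (x∈p⇒∣p-x∣<∣p∣ x∈)
    where
    y∈′ = x∈p∧x≢y⇒x∈p-y y∈ y≢x
    z∈″ = x∈p∧x≢y⇒x∈p-y (x∈p∧x≢y⇒x∈p-y z∈ z≢x) z≢y

  -- Adding edges on the same vertex set preserves connectivity, also after deleting a vertex.
  -- Blocks can thus be sought among induced subgraphs, where only the vertex set can grow.
  twoConnected-induced : (G H : Graph n) → H ⊑ G → TwoConnected H →
                         TwoConnected (induced G (V H))
  twoConnected-induced G H (_ , H⇒G) (card , conn , conn-del) =
    card ,
    connected-spanning H K id id H⇒K conn ,
    λ {x} x∈ → connected-spanning (deleteVertex H x) (deleteVertex K x) id id
                 (λ (uv , u≢x , v≢x) → H⇒K uv , u≢x , v≢x) (conn-del x∈)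
    where
    K = induced G (V H)
    H⇒K : ∀ {u v} → Adj H u v → Adj K u v
    H⇒K uv = H⇒G uv , adj⇒∈ H uv , adj⇒∈ʳ H uv

  -- The subgraph induced on V H is a block unless some 2-connected subgraph
  -- has strictly more vertices; m bounds the number of such enlargements.
  twoConnected⇒clique :
    (G : Graph n) → (∀ B → Block G B → Complete B) →
    ∀ m (H : Graph n) → H ⊑ G → TwoConnected H → n ≤ m + ∣ V H ∣ →
    ∀ {a b} → a ∈ V H → b ∈ V H → a ≢ b → Adj G a b
  twoConnected⇒clique G complete m H H⊑G 2c n≤ {a} {b} a∈ b∈ a≢b =
    -- Maximality of `B` is not decided outright. Adjacency is decidable, so `¬ab` may be assumed; a
    -- larger 2-connected subgraph would then refute it by recursion.
    decidable-stable (adj? G a b) λ ¬ab →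
      ¬ab (proj₁ (complete B (inj₁ (B⊑G , twoConnected-induced G H H⊑G 2c , maximal m n≤ ¬ab))
                           a∈ b∈ a≢b))
    where
    B = induced G (V H)
    B⊑G : B ⊑ G
    B⊑G = proj₁ H⊑G , proj₁
    maximal : ∀ m → n ≤ m + ∣ V H ∣ → ¬ Adj G a b →
              ∀ K → K ⊑ G → TwoConnected K → B ⊑ K → K ⊑ B
    maximal m n≤ ¬ab K K⊑G 2cK (H⊆K , _)
      with any? (λ z → z ∈? V K ×-dec ¬? (z ∈? V H))
    ... | no none =
      K⊆H , λ uv → proj₂ K⊑G uv , K⊆H (adj⇒∈ K uv) , K⊆H (adj⇒∈ʳ K uv)
      where
      K⊆H : V K ⊆ˢ V H
      K⊆H {z} z∈K = decidable-stable (z ∈? V H) λ z∉H → none (z , z∈K , z∉H)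
    maximal zero n≤ ¬ab K K⊑G 2cK (H⊆K , _) | yes (z , z∈K , z∉H) =
      contradiction (≤-trans (p⊂q⇒∣p∣<∣q∣ (H⊆K , z , z∈K , z∉H)) (∣p∣≤n (V K))) (≤⇒≯ n≤)
    maximal (suc m) n≤ ¬ab K K⊑G 2cK (H⊆K , _) | yes (z , z∈K , z∉H) =
      contradiction
        (twoConnected⇒clique G complete m K K⊑G 2cK
          (≤-trans n≤ (≤-trans (≤-reflexive (≡-sym (+-suc m ∣ V H ∣)))
                               (+-monoʳ-≤ m (p⊂q⇒∣p∣<∣q∣ (H⊆K , z , z∈K , z∉H)))))
          (H⊆K a∈) (H⊆K b∈) a≢b)
        ¬ab

  -- Once loops are erased, the detour and `x` form a cycle, and the subgraph induced on it is
  -- 2-connected: deleting `x` leaves the path, and deleting another vertex leaves segments attached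
  -- to `x`.
  detour⇒adj : (G : Graph n) → (∀ B → Block G B → Complete B) →
               ∀ {a x b} → Adj G a x → Adj G x b → a ≢ b →
               Walk (deleteVertex G x) a b → Adj G a b
  detour⇒adj G complete {a} {x} {b} ax xb a≢b walk with loopErasure (deleteVertex G x) walk
  ... | (w , uniq) , _ =
    -- At most `n` enlargements are possible, so the budget `n` suffices whatever the size of `H`.
    twoConnected⇒clique G complete n H H⊑G (card , conn , conn-del) (m≤m+n n _)
      a∈S b∈S a≢b
    where
    G-x = deleteVertex G x
    P = vertices G-x w
    S = fromList (x ∷ P)
    H = induced G S

    a≢x : a ≢ x
    a≢x refl = irrefl G refl ax
    b≢x : b ≢ x
    b≢x refl = irrefl G refl xb

    P⊆V-x : ∀ {z} → z ∈ˡ P → z ∈ V G - x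
    P⊆V-x = vertices⊆V G-x (x∈p∧x≢y⇒x∈p-y (adj⇒∈ G ax) a≢x) w

    P⊆S : ∀ {z} → z ∈ˡ P → z ∈ S
    P⊆S z∈ = ∈-fromList⁺ {xs = x ∷ P} (there z∈)

    a∈S : a ∈ S
    a∈S = P⊆S (start∈vertices G-x w)
    b∈S : b ∈ S
    b∈S = P⊆S (end∈vertices G-x w)
    x∈S : x ∈ S
    x∈S = ∈-fromList⁺ {xs = x ∷ P} (here refl)

    H⊑G : H ⊑ G
    H⊑G = (λ z∈ → S⊆V (∈-fromList⁻ (x ∷ P) z∈)) , proj₁
      where
      S⊆V : ∀ {z} → z ∈ˡ x ∷ P → z ∈ V G
      S⊆V (here refl) = adj⇒∈ G xb
      S⊆V (there z∈)  = x∈p-y⇒x∈p (P⊆V-x z∈)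

    card : 2 < ∣ S ∣
    card = 2<∣p∣ x∈S a∈S b∈S a≢x b≢x (≢-sym a≢b)

    keep : ∀ {y p q} → Adj G-x p q → p ∈ S × p ≢ y → q ∈ S × q ≢ y →
           Adj (deleteVertex H y) p q
    keep (pq , _) (p∈ , p≢y) (q∈ , q≢y) = (pq , p∈ , q∈) , p≢y , q≢y

    toEnd : ∀ {z} → z ∈ˡ P → Walk (deleteVertex H x) z b
    toEnd z∈ with suffix G-x w z∈
    ... | w′ , _ , sub , _ =
      restrict G-x (deleteVertex H x) keep w′ λ z∈′ →
        P⊆S (sub z∈′) , x∈p-y⇒x≢y (P⊆V-x (sub z∈′))

    conn : Connected H
    conn = hub⇒connected H x∈S λ z∈ → toHub (∈-fromList⁻ (x ∷ P) z∈)
      where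
      toHub : ∀ {z} → z ∈ˡ x ∷ P → Walk H z x
      toHub (here refl) = ε
      toHub (there z∈)  = Star.map proj₁ (toEnd z∈) ◅◅ (sym G xb , b∈S , x∈S) ◅ ε

    conn-del : ∀ {y} → y ∈ S → Connected (deleteVertex H y)
    conn-del {y} _ with x ≟ y
    ... | yes refl =
      hub⇒connected (deleteVertex H x) (x∈p∧x≢y⇒x∈p-y b∈S b≢x) λ z∈ →
        toHub (∈-fromList⁻ (x ∷ P) (x∈p-y⇒x∈p z∈)) (x∈p-y⇒x≢y z∈)
      where
      toHub : ∀ {z} → z ∈ˡ x ∷ P → z ≢ x → Walk (deleteVertex H x) z b
      toHub (here refl) z≢x = contradiction refl z≢x
      toHub (there z∈)  _   = toEnd z∈
    ... | no x≢y =
      hub⇒connected (deleteVertex H y) (x∈p∧x≢y⇒x∈p-y x∈S x≢y) λ z∈ →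
        toHub (∈-fromList⁻ (x ∷ P) (x∈p-y⇒x∈p z∈)) (x∈p-y⇒x≢y z∈)
      where
      toHub : ∀ {z} → z ∈ˡ x ∷ P → z ≢ y → Walk (deleteVertex H y) z x
      toHub (here refl) _ = ε
      toHub (there z∈) z≢y
        -- Each piece of the path left by deleting `y` keeps `a` or `b`, and both are neighbours of
        -- `x`.
        with pathEnd G-x (deleteVertex H y) {T = _∈ S} keep w uniq P⊆S z∈ z≢y
      ... | inj₁ (a≢y , za) = za ◅◅ ((ax , a∈S , x∈S) , a≢y , x≢y) ◅ ε
      ... | inj₂ (b≢y , zb) = zb ◅◅ ((sym G xb , b∈S , x∈S) , b≢y , x≢y) ◅ ε

  -- Distances

  minimum : {P : Pred ℕ 0ℓ} → Decidable P → ∀ {m} → P m → ∃ (IsMinimum {n} P)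
  -- `search` covers only numbers strictly below its argument, hence `suc m` in order to include the
  -- witness `m`.
  minimum {P} P? {m} Pm with search (suc m)
    where
    search : ∀ m → ∃ (IsMinimum {n} P) ⊎ (∀ {j} → j < m → ¬ P j)
    search zero = inj₂ λ ()
    search (suc m) with search m
    ... | inj₁ found = inj₁ found
    ... | inj₂ none with P? m
    ...   | yes Pm = inj₁ (m , Pm , λ Pj → ≮⇒≥ λ j<m → none j<m Pj)
    ...   | no ¬Pm = inj₂ below
      where
      below : ∀ {j} → j < suc m → ¬ P j
      below j<1+m with m<1+n⇒m<n∨m≡n j<1+m
      ... | inj₁ j<m  = none j<m
      ... | inj₂ refl = ¬Pm
  ... | inj₁ found = found
  ... | inj₂ none  = contradiction Pm (none ≤-refl)

  -- Recursion on the first step leaves a search over the finitely many successors. With walks no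
  -- set of visited vertices has to be tracked; `distance-d` returns to paths.
  walkOfLength? : (G : Graph n) → ∀ k u v →
                  Dec (Σ (Walk G u v) λ w → length G w ≡ k)
  walkOfLength? G zero u v =
    map′ (λ { refl → ε , refl }) (λ { (ε , _) → refl ; (_ ◅ _ , ()) }) (u ≟ v)
  walkOfLength? G (suc k) u v =
    map′ (λ { (_ , e , w , refl) → e ◅ w , refl })
         (λ { (ε , ()) ; (e ◅ w , refl) → _ , e , w , refl })
         (any? λ c → adj? G u c ×-dec walkOfLength? G k c v)

  module Metric (G : Graph n) (conn : Connected G) where

    -- Membership is assumed only inside the existential, so the number depends on the two vertices
    -- and not on membership proofs.
    distance : ∀ u v → ∃[ k ] (u ∈ V G → v ∈ V G →
               IsMinimum {n} (λ k → Σ (Walk G u v) λ w → length G w ≡ k) k)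
    distance u v with u ∈? V G ×-dec v ∈? V G
    ... | no ¬uv = 0 , λ u∈ v∈ → contradiction (u∈ , v∈) ¬uv
    ... | yes (u∈ , v∈)
      with minimum (λ k → walkOfLength? G k u v) (proj₁ (proj₂ conn u∈ v∈) , refl)
    ...   | k , min = k , λ _ _ → min

    -- Outside V G the value of d is junk.
    d : Fin n → Fin n → ℕ
    d u v = proj₁ (distance u v)

    geodesic : ∀ {u v} → u ∈ V G → v ∈ V G → Σ (Walk G u v) λ w → length G w ≡ d u v
    geodesic u∈ v∈ = proj₁ (proj₂ (distance _ _) u∈ v∈)

    d≤length : ∀ {u v} → u ∈ V G → v ∈ V G → (w : Walk G u v) → d u v ≤ length G w
    d≤length u∈ v∈ w = proj₂ (proj₂ (distance _ _) u∈ v∈) (w , refl)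

    d≡0⇒≡ : ∀ {u v} → u ∈ V G → v ∈ V G → d u v ≡ 0 → u ≡ v
    d≡0⇒≡ u∈ v∈ d≡0 with geodesic u∈ v∈
    ... | ε     , _   = refl
    ... | _ ◅ _ , len with () ← trans len d≡0

    d-sym-≤ : ∀ {u v} → u ∈ V G → v ∈ V G → d u v ≤ d v u
    d-sym-≤ u∈ v∈ with geodesic v∈ u∈
    ... | w , len = ≤-trans (d≤length u∈ v∈ (Star.reverse (sym G) w))
                            (≤-reflexive (trans (length-reverse G w) len))

    d-sym : ∀ {u v} → u ∈ V G → v ∈ V G → d u v ≡ d v u
    d-sym u∈ v∈ = ≤-antisym (d-sym-≤ u∈ v∈) (d-sym-≤ v∈ u∈)

    d-triangle : ∀ {u v w} → u ∈ V G → v ∈ V G → w ∈ V G → d u w ≤ d u v + d v w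
    d-triangle u∈ v∈ w∈ with geodesic u∈ v∈ | geodesic v∈ w∈
    ... | p , p≡ | q , q≡ =
      ≤-trans (d≤length u∈ w∈ (p ◅◅ q))
              (≤-reflexive (trans (length-◅◅ G p q) (cong₂ _+_ p≡ q≡)))

    d-via : ∀ {u v w} → u ∈ V G → v ∈ V G → w ∈ V G → d u w ≤ d v u + d v w
    d-via u∈ v∈ w∈ = subst (λ k → _ ≤ k + _) (d-sym u∈ v∈) (d-triangle u∈ v∈ w∈)

    adj⇒d≤1 : ∀ {u v} → Adj G u v → d u v ≤ 1
    adj⇒d≤1 uv = d≤length (adj⇒∈ G uv) (adj⇒∈ʳ G uv) (uv ◅ ε)

    d-adj : ∀ {u v r} → Adj G u v → r ∈ V G → d u r ≤ suc (d v r)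
    d-adj uv r∈ = ≤-trans (d-triangle (adj⇒∈ G uv) (adj⇒∈ʳ G uv) r∈)
                          (+-monoˡ-≤ _ (adj⇒d≤1 uv))

    adj⇒1≤d : ∀ {u v} → Adj G u v → 1 ≤ d u v
    adj⇒1≤d {u} {v} uv = n≢0⇒n>0 λ d≡0 →
      irrefl G (d≡0⇒≡ (adj⇒∈ G uv) (adj⇒∈ʳ G uv) d≡0) uv

    step : ∀ {u v k} → u ∈ V G → v ∈ V G → d u v ≡ suc k →
           ∃[ c ] Adj G u c × d c v ≡ k
    step u∈ v∈ d≡ with geodesic u∈ v∈
    ... | ε , len with () ← trans len d≡
    ... | _◅_ {j = c} e w , len =
      c , e , ≤-antisym
        (≤-trans (d≤length (adj⇒∈ʳ G e) v∈ w) (≤-reflexive (suc-injective (trans len d≡))))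
        (s≤s⁻¹ (≤-trans (≤-reflexive (≡-sym d≡)) (d-adj e v∈)))

    distance-d : ∀ {u v} → u ∈ V G → v ∈ V G → Distance G u v (d u v)
    distance-d {u} {v} u∈ v∈ with geodesic u∈ v∈
    ... | w , len with loopErasure G w
    ...   | p , p≤ =
      (p , ≤-antisym (≤-trans p≤ (≤-reflexive len)) (d≤length u∈ v∈ (proj₁ p))) ,
      λ { (q , refl) → d≤length u∈ v∈ (proj₁ q) }

    distance-unique : ∀ {u v k} → u ∈ V G → v ∈ V G → Distance G u v k → k ≡ d u v
    distance-unique u∈ v∈ (attained , least) with distance-d u∈ v∈
    ... | attained′ , least′ = ≤-antisym (least attained′) (least′ attained)

    -- Every later vertex of a geodesic from `a` is strictly nearer to `r` than `x` is, hence
    -- differs from `x`. Only the start can tie with `x`, so `a ≢ x` is assumed.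
    descend : ∀ k {a r x} → a ∈ V G → r ∈ V G → a ≢ x → d a r ≡ k → k ≤ d x r →
              Walk (deleteVertex G x) a r
    descend zero a∈ r∈ a≢x d≡ k≤ with refl ← d≡0⇒≡ a∈ r∈ d≡ = ε
    descend (suc k) {x = x} a∈ r∈ a≢x d≡ k≤ with step a∈ r∈ d≡
    ... | c , ac , refl = (ac , a≢x , c≢x) ◅ descend k (adj⇒∈ʳ G ac) r∈ c≢x refl (<⇒≤ k≤)
      where
      c≢x : c ≢ x
      c≢x refl = <-irrefl refl k≤

    diametral : ∃[ a ] ∃[ b ] a ∈ V G × b ∈ V G ×
                (∀ {u v} → u ∈ V G → v ∈ V G → d u v ≤ d a b)
    diametral = proj₁ ab , proj₂ ab , proj₁ ab∈ , proj₂ ab∈ ,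
      λ u∈ v∈ → All.lookup (f[xs]≤f[argmax] {f = uncurry d} ⊥ₚ pairs)
                  (∈-cartesianProduct⁺ (∈-filter⁺ (_∈? V G) (∈-allFin _) u∈)
                                       (∈-filter⁺ (_∈? V G) (∈-allFin _) v∈))
      where
      Vs = filter (_∈? V G) (allFin n)
      pairs = cartesianProduct Vs Vs
      z = proj₁ (proj₁ conn)
      -- `argmax` may return its default, so the default must itself be a pair of vertices of `G`;
      -- nonemptiness supplies one.
      ⊥ₚ = z , z
      ab = argmax (uncurry d) ⊥ₚ pairs
      ab∈ : proj₁ ab ∈ V G × proj₂ ab ∈ V G
      ab∈ = argmax-all (uncurry d) {P = λ (u , v) → u ∈ V G × v ∈ V G}
        (proj₂ (proj₁ conn) , proj₂ (proj₁ conn))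
        (All.tabulate λ uv∈ → let u∈ , v∈ = ∈-cartesianProduct⁻ Vs Vs uv∈ in
          proj₂ (∈-filter⁻ (_∈? V G) {xs = allFin n} u∈) ,
          proj₂ (∈-filter⁻ (_∈? V G) {xs = allFin n} v∈))

  -- The four-point condition

  +-replaceˡ : ∀ {m p q r} k → m ≤ p + q → p + k ≤ r → m + k ≤ r + q
  +-replaceˡ {m} {p} {q} {r} k m≤ ≤r = begin
    m + k       ≤⟨ +-monoˡ-≤ k m≤ ⟩
    p + q + k   ≡⟨ +-assoc p q k ⟩
    p + (q + k) ≡⟨ cong (p +_) (+-comm q k) ⟩
    p + (k + q) ≡⟨ +-assoc p k q ⟨
    p + k + q   ≤⟨ +-monoˡ-≤ q ≤r ⟩
    r + q       ∎
    where open ≤-Reasoning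

  +-replaceʳ : ∀ {m p q r} k → m ≤ p + q → q + k ≤ r → m + k ≤ p + r
  +-replaceʳ {m} {p} {q} {r} k m≤ ≤r = begin
    m + k       ≤⟨ +-monoˡ-≤ k m≤ ⟩
    p + q + k   ≡⟨ +-assoc p q k ⟩
    p + (q + k) ≤⟨ +-monoʳ-≤ p ≤r ⟩
    p + r       ∎
    where open ≤-Reasoning

  module BlockGraphMetric (G : Graph n) (bg : BlockGraph G) where

    open Metric G (proj₁ bg)

    -- By `descend`, `a` and `b` both reach `r` without meeting `x`; the two walks joined at `r`
    -- form a detour around `x`.
    neighbours-adjacent : ∀ {a x b r} → Adj G a x → Adj G x b → r ∈ V G →
                          d a r ≤ d x r → d b r ≤ d x r → a ≡ b ⊎ Adj G a b
    neighbours-adjacent {a} {x} {b} {r} ax xb r∈ a≤ b≤ with a ≟ b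
    ... | yes a≡b = inj₁ a≡b
    ... | no  a≢b = inj₂ (detour⇒adj G (proj₂ bg) ax xb a≢b
        (descend _ (adj⇒∈ G ax) r∈ (λ { refl → irrefl G refl ax }) refl a≤ ◅◅
         Star.reverse (sym (deleteVertex G x))
           (descend _ (adj⇒∈ʳ G xb) r∈ (λ { refl → irrefl G refl xb }) refl b≤)))

    -- If the next vertex `a″` of the geodesic were no farther from `r` than `a′`, then `a` and `a″`
    -- would be equal or adjacent, a shortcut to `b`. So each of the `k` remaining steps gains one.
    ascend : ∀ k {a a′ b r} → Adj G a a′ → b ∈ V G → r ∈ V G →
             d a b ≡ suc k → d a′ b ≡ k → d a r ≤ d a′ r → d a′ r + k ≤ d b r
    ascend zero {r = r} aa′ b∈ r∈ _ d≡ _ with refl ← d≡0⇒≡ (adj⇒∈ʳ G aa′) b∈ d≡ =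
      ≤-reflexive (+-identityʳ _)
    ascend (suc k) {a} {a′} {b} {r} aa′ b∈ r∈ ab≡ a′b≡ a≤a′ with step (adj⇒∈ʳ G aa′) b∈ a′b≡
    ... | a″ , a′a″ , a″b≡ = begin
      d a′ r + suc k   ≡⟨ +-suc _ k ⟩
      suc (d a′ r) + k ≤⟨ +-monoˡ-≤ k up ⟩
      d a″ r + k       ≤⟨ ascend k a′a″ b∈ r∈ a′b≡ a″b≡ (<⇒≤ up) ⟩
      d b r            ∎
      where
      open ≤-Reasoning
      far : suc (d a″ b) < d a b
      far = ≤-reflexive (trans (cong (suc ∘ suc) a″b≡) (≡-sym ab≡))
      up : d a′ r < d a″ r
      up = ≰⇒> λ a″≤a′ → case (neighbours-adjacent aa′ a′a″ r∈ a≤a′ a″≤a′)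
        where
        case : ¬ (a ≡ a″ ⊎ Adj G a a″)
        case (inj₁ refl) = <⇒≱ far (n≤1+n _)
        case (inj₂ aa″)  = <⇒≱ far (d-adj aa″ b∈)

    -- The first vertex `p` of a geodesic from `x` to `r` and the vertex `y` are neighbours of `x`
    -- no farther from `r` than `x`. They differ in distance to `r`, so they are adjacent.
    commonParent : ∀ {x y r} → Adj G x y → r ∈ V G → d x r ≡ d y r →
                   ∃[ p ] Adj G p x × Adj G p y × suc (d p r) ≡ d x r
    commonParent {x} {y} {r} xy r∈ x≡y with d x r in x≡
    ... | zero = contradiction xy
      (irrefl G (trans (d≡0⇒≡ (adj⇒∈ G xy) r∈ x≡)
                       (≡-sym (d≡0⇒≡ (adj⇒∈ʳ G xy) r∈ (≡-sym x≡y)))))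
    ... | suc k with step (adj⇒∈ G xy) r∈ x≡
    ...   | p , xp , refl = p , sym G xp , py , refl
      where
      py : Adj G p y
      py with neighbours-adjacent (sym G xp) xy r∈
                (≤-trans (n≤1+n _) (≤-reflexive (≡-sym x≡)))
                (≤-reflexive (trans (≡-sym x≡y) (≡-sym x≡)))
      ... | inj₁ refl = contradiction (≡-sym x≡y) λ eq → <-irrefl eq (n<1+n _)
      ... | inj₂ adj  = adj

    -- The common parents of the edge xy towards u and towards v are
    -- equal or adjacent, being neighbours of both x and y.
    level-edge : ∀ {x y u v} → Adj G x y → u ∈ V G → v ∈ V G →
                 d x u ≡ d y u → d x v ≡ d y v → suc (d u v) ≤ d x u + d x v
    level-edge {x} {y} {u} {v} xy u∈ v∈ xu≡ xv≡
      with commonParent xy u∈ xu≡ | commonParent xy v∈ xv≡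
    ... | p , px , py , pu | q , qx , qy , qv = begin
      suc (d u v)               ≤⟨ s≤s (d-via u∈ p∈ v∈) ⟩
      suc (d p u) + d p v       ≤⟨ +-monoʳ-≤ (suc (d p u)) pv≤ ⟩
      suc (d p u) + suc (d q v) ≡⟨ cong (_+ suc (d q v)) pu ⟩
      d x u + suc (d q v)       ≡⟨ cong (d x u +_) qv ⟩
      d x u + d x v             ∎
      where
      open ≤-Reasoning
      p∈ = adj⇒∈ G px
      pv≤ : d p v ≤ suc (d q v)
      -- The reference vertex is now `y`: both `p` and `q` are within distance 1 of it, and `x` is
      -- at distance at least 1.
      pv≤ with neighbours-adjacent px (sym G qx) (adj⇒∈ʳ G xy)
                 (≤-trans (adj⇒d≤1 py) (adj⇒1≤d xy)) (≤-trans (adj⇒d≤1 qy) (adj⇒1≤d xy))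
      ... | inj₁ refl = n≤1+n _
      ... | inj₂ pq   = d-adj pq v∈

    -- Induction along a geodesic from `a` to `b`, comparing the distances to `u` and to `v` before
    -- and after its first step. A rise settles the claim by `ascend` and the triangle inequality.
    fourPoint : ∀ k {a b u v} → a ∈ V G → b ∈ V G → u ∈ V G → v ∈ V G → d a b ≡ k →
                d u v + k ≤ d a u + d b v ⊎ d u v + k ≤ d b u + d a v
    fourPoint zero a∈ b∈ u∈ v∈ ab≡ with refl ← d≡0⇒≡ a∈ b∈ ab≡ =
      inj₁ (≤-trans (≤-reflexive (+-identityʳ _)) (d-via u∈ a∈ v∈))
    fourPoint (suc k) {a} {b} {u} {v} a∈ b∈ u∈ v∈ ab≡ with step a∈ b∈ ab≡
    ... | a′ , aa′ , a′b≡ = conclude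
      where
      a′∈ = adj⇒∈ʳ G aa′

      climb : ∀ {r} → r ∈ V G → d a r < d a′ r → d a r + suc k ≤ d b r
      climb r∈ a<a′ = ≤-trans (≤-reflexive (+-suc _ k))
        (≤-trans (+-monoˡ-≤ k a<a′) (ascend k aa′ b∈ r∈ ab≡ a′b≡ (<⇒≤ a<a′)))

      level : ∀ {r} → r ∈ V G → d a r ≡ d a′ r → d a r + k ≤ d b r
      level r∈ a≡a′ = ≤-trans (≤-reflexive (cong (_+ k) a≡a′))
                              (ascend k aa′ b∈ r∈ ab≡ a′b≡ (≤-reflexive a≡a′))

      +suc : ∀ {s} → suc (d u v) + k ≤ s → d u v + suc k ≤ s
      +suc = ≤-trans (≤-reflexive (+-suc _ k))

      via-a′ : d u v ≤ d a′ u + d a′ v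
      via-a′ = d-via u∈ a′∈ v∈

      levelᵘ : d a u ≡ d a′ u → suc (d u v) ≤ d a u + d a v →
               d u v + suc k ≤ d b u + d a v
      levelᵘ u≡ uv< = +suc (+-replaceˡ k uv< (level u∈ u≡))

      levelᵛ : d a v ≡ d a′ v → suc (d u v) ≤ d a u + d a v →
               d u v + suc k ≤ d a u + d b v
      levelᵛ v≡ uv< = +suc (+-replaceʳ {p = d a u} k uv< (level v∈ v≡))

      conclude : d u v + suc k ≤ d a u + d b v ⊎ d u v + suc k ≤ d b u + d a v
      conclude with <-cmp (d a u) (d a′ u) | <-cmp (d a v) (d a′ v)
      ... | tri< u< _ _ | _ = inj₂ (+-replaceˡ (suc k) (d-via u∈ a∈ v∈) (climb u∈ u<))
      ... | _ | tri< v< _ _ =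
        inj₁ (+-replaceʳ {p = d a u} (suc k) (d-via u∈ a∈ v∈) (climb v∈ v<))
      -- A level first step makes `ascend` yield only `k`. The missing unit comes from `level-edge`
      -- when both distances are level, and from the detour through `a′` when the other one drops.
      ... | tri≈ _ u≡ _ | tri≈ _ v≡ _ = inj₂ (levelᵘ u≡ (level-edge aa′ u∈ v∈ u≡ v≡))
      ... | tri≈ _ u≡ _ | tri> _ _ v> = inj₂ (levelᵘ u≡
        (≤-trans (s≤s via-a′) (≤-trans (≤-reflexive (≡-sym (+-suc _ _)))
                                       (+-mono-≤ (≤-reflexive (≡-sym u≡)) v>))))
      ... | tri> _ _ u> | tri≈ _ v≡ _ = inj₁ (levelᵛ v≡
        (≤-trans (s≤s via-a′) (+-mono-≤ u> (≤-reflexive (≡-sym v≡)))))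
      -- When both distances drop, moving back from `a′` to `a` adds at least one to either
      -- right-hand side of the induction hypothesis.
      ... | tri> _ _ u> | tri> _ _ v> with fourPoint k a′∈ b∈ u∈ v∈ a′b≡
      ...   | inj₁ ih = inj₁ (+suc (≤-trans (s≤s ih) (+-monoˡ-≤ _ u>)))
      ...   | inj₂ ih = inj₂ (+suc (≤-trans (s≤s ih)
                (≤-trans (≤-reflexive (≡-sym (+-suc _ _))) (+-monoʳ-≤ (d b u) v>))))

  -- Peripheries in block graphs

  hangable : (G : Graph n) → BlockGraph G → Hangable G
  hangable G bg = proj₁ bg , periphery
    where
    open Metric G (proj₁ bg)
    open BlockGraphMetric G bg
    periphery : ∀ {v} → v ∈ V G → ∀ {u} → PeripheryOf G v u → Periphery G u
    periphery {v} v∈ {u} (u∈ , k , duv , _ , k-max) with diametral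
    ... | a , b , a∈ , b∈ , diam = u∈ , d a b , ecc-u , (a , a∈ , ecc-a) , diam-max
      where
      far : ∀ {w} → w ∈ V G → d w v ≤ d u v
      far {w} w∈ = begin
        d w v ≡⟨ d-sym w∈ v∈ ⟩
        d v w ≤⟨ k-max (w , w∈ , distance-d v∈ w∈) ⟩
        k     ≡⟨ distance-unique v∈ u∈ duv ⟩
        d v u ≡⟨ d-sym v∈ u∈ ⟩
        d u v ∎
        where open ≤-Reasoning

      eccentricity : ∀ {x y} → x ∈ V G → y ∈ V G → d a b ≤ d y x →
                     Eccentricity G x (d a b)
      eccentricity {x} {y} x∈ y∈ ab≤ =
        (y , y∈ , subst (Distance G x y) xy≡ (distance-d x∈ y∈)) ,
        λ (w , w∈ , dxw) → subst (_≤ d a b) (≡-sym (distance-unique x∈ w∈ dxw)) (diam x∈ w∈)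
        where
        xy≡ : d x y ≡ d a b
        xy≡ = ≤-antisym (diam x∈ y∈) (≤-trans ab≤ (d-sym-≤ y∈ x∈))

      ecc-a : Eccentricity G a (d a b)
      ecc-a = eccentricity a∈ b∈ (d-sym-≤ a∈ b∈)

      ecc-u : Eccentricity G u (d a b)
      ecc-u with fourPoint (d a b) a∈ b∈ u∈ v∈ refl
      -- Since `b` is no farther from `v` than `u` is, `d u v` cancels and leaves `d a b ≤ d a u`;
      -- the other case exchanges `a` and `b`.
      ... | inj₁ le = eccentricity u∈ a∈ (+-cancelˡ-≤ (d u v) _ _
              (≤-trans le (≤-trans (+-monoʳ-≤ (d a u) (far b∈))
                                   (≤-reflexive (+-comm (d a u) (d u v))))))
      ... | inj₂ le = eccentricity u∈ b∈ (+-cancelˡ-≤ (d u v) _ _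
              (≤-trans le (≤-trans (+-monoʳ-≤ (d b u) (far a∈))
                                   (≤-reflexive (+-comm (d b u) (d u v))))))

      diam-max : ∀ {m} → (∃[ x ] x ∈ V G × Eccentricity G x m) → m ≤ d a b
      diam-max (x , x∈ , (w , w∈ , dxw) , _) =
        subst (_≤ d a b) (≡-sym (distance-unique x∈ w∈ dxw)) (diam x∈ w∈)

theorem1 : ∀ (n : ℕ) (G : Graph n) → BlockGraph G → Hangable G
theorem1 n = hangable
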